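{- Let $d \geq 1$, let $\mathcal{C}$ be a $d$-clutter on vertex set $[n]$, let $\mathbb{K}$ be a field and $R = \mathbb{K}[x_1,\dots,x_n]$, and let $e \in \mathcal{C}$ be a circuit. Let $\overline{\mathcal{C}}$ be the complement of $\mathcal{C}$ and $I_{\overline{\mathcal{C}}} \subset R$ its circuit ideal. Then $e$ is an exposed circuit of $\mathcal{C}$ if and only if $\mathbf{x}_e$ is a linear divisor for $I_{\overline{\mathcal{C}}}$. Moreover, for $K \subset [n]$, $K$ is the unique maximal clique of $\mathcal{C}$ containing $e$ if and only if the colon ideal $(I_{\overline{\mathcal{C}}} : \mathbf{x}_e)$ is generated by the variables corresponding to the vertices outside $K$, i.e. $(I_{\overline{\mathcal{C}}} : \mathbf{x}_e) = \langle x_i : i \in [n]\setminus K\rangle$.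
   Context: A $d$-clutter on $[n]=\{1,\dots,n\}$ is a collection $\mathcal{C}$ of $d$-element subsets of $[n]$, called circuits. The complement $\overline{\mathcal{C}}$ is the $d$-clutter on $[n]$ consisting of all $d$-subsets of $[n]$ not in $\mathcal{C}$. A clique ($d$-clique) of $\mathcal{C}$ is a nonempty $S \subset [n]$ such that either $|S|<d$, or $|S|\ge d$ and every $d$-subset of $S$ is a circuit of $\mathcal{C}$; it is maximal if it is maximal under inclusion among cliques. A circuit $e\in\mathcal{C}$ is exposed if it is contained in a unique maximal clique of $\mathcal{C}$. For $e=\{v_1,\dots,v_d\}\subset[n]$, $\mathbf{x}_e = x_{v_1}\cdots x_{v_d}$. The circuit ideal of a $d$-clutter $\mathcal{D}$ is $I_{\mathcal{D}} = \langle \mathbf{x}_f : f\in\mathcal{D}\rangle \subset R$. For a monomial ideal $I\subset R$ and a squarefree monomial $\mathbf{x}_e$ that is not a generator of $I$, $\mathbf{x}_e$ is a linear divisor for $I$ if the colon ideal $(I:\mathbf{x}_e)=\{r\in R : r\mathbf{x}_e\in I\}$ is generated by a (possibly empty) subset of the variables $\{x_1,\dots,x_n\}$. -}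

module Defs where

open import Level using (Level; 0ℓ; _⊔_) renaming (suc to lsuc)
open import Algebra.Bundles using (CommutativeRing)
open import Algebra.Apartness.Bundles using (HeytingField; HeytingCommutativeRing)
import Algebra.Properties.Ring as RingProperties
open import Data.Bool.Base using (if_then_else_)
open import Data.Fin.Base using (Fin)
open import Data.Fin.Subset using (Subset; _∈_; _⊆_; ∣_∣; ⁅_⁆; Nonempty)
open import Data.List.Base using (List; []; _∷_; _++_; map; cartesianProductWith)
open import Data.Nat.Base as ℕ using (ℕ)
import Data.Nat.Properties as ℕₚ
open import Data.Product.Base using (Σ; ∃; _×_; _,_; proj₁; proj₂)
open import Data.Sum.Base using (_⊎_)
open import Data.Vec.Base as Vec using (Vec; []; _∷_; zipWith; replicate)
import Data.Vec.Properties as Vecₚ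
open import Relation.Binary.PropositionalEquality as ≡ using (_≡_; _≢_)
open import Relation.Nullary.Decidable using (Dec; does; yes; no; _×-dec_; ¬?)
open import Relation.Nullary.Negation using (¬_; contradiction)
open import Relation.Unary using (Pred; Decidable; _≐_)

private
  variable
    c ℓ i : Level
    d n : ℕ

-- Circuits are required to be decidable: this holds classically for any set
-- of subsets of a finite set, and makes a clutter an honest finite object.
record Clutter (d n : ℕ) : Set₁ where
  field
    Circuit  : Pred (Subset n) 0ℓ
    circuit? : Decidable Circuit
    uniform  : ∀ {f} → Circuit f → ∣ f ∣ ≡ d

open Clutter public

complement : Clutter d n → Clutter d n
complement {d} C = record
  { Circuit  = λ f → ∣ f ∣ ≡ d × ¬ Circuit C f
  ; circuit? = λ f → (∣ f ∣ ℕₚ.≟ d) ×-dec ¬? (circuit? C f)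
  ; uniform  = proj₁
  }

IsClique : Clutter d n → Pred (Subset n) 0ℓ
IsClique {d} C S =
  Nonempty S ×
  (∣ S ∣ ℕ.< d ⊎ (d ℕ.≤ ∣ S ∣ × (∀ f → f ⊆ S → ∣ f ∣ ≡ d → Circuit C f)))

IsMaximalClique : Clutter d n → Pred (Subset n) 0ℓ
IsMaximalClique C S = IsClique C S × (∀ T → IsClique C T → S ⊆ T → T ≡ S)

IsUniqueMaximalCliqueContaining : Clutter d n → Subset n → Pred (Subset n) 0ℓ
IsUniqueMaximalCliqueContaining C e K =
  (IsMaximalClique C K × e ⊆ K) ×
  (∀ K′ → IsMaximalClique C K′ → e ⊆ K′ → K′ ≡ K)

IsExposed : Clutter d n → Pred (Subset n) 0ℓ
IsExposed C e = Circuit C e × ∃ (IsUniqueMaximalCliqueContaining C e)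

-- Given by its vector of exponents.
Monomial : ℕ → Set
Monomial = Vec ℕ

infixl 7 _·_

_·_ : Monomial n → Monomial n → Monomial n
_·_ = zipWith ℕ._+_

𝟙 : Monomial n
𝟙 = replicate _ 0

infix 4 _≟ₘ_ _∣ₘ_

_≟ₘ_ : (u v : Monomial n) → Dec (u ≡ v)
_≟ₘ_ = Vecₚ.≡-dec ℕₚ._≟_

_∣ₘ_ : Monomial n → Monomial n → Set
u ∣ₘ v = ∃ λ w → u · w ≡ v

squarefree : Subset n → Monomial n
squarefree = Vec.map λ s → if s then 1 else 0

-- Subtraction of exponents is truncated: v ÷ u is the quotient only if u ∣ₘ v.
_÷_ : Monomial n → Monomial n → Monomial n
_÷_ = zipWith ℕ._∸_

u·v÷u : ∀ (u v : Monomial n) → (u · v) ÷ u ≡ v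
u·v÷u []      []      = ≡.refl
u·v÷u (x ∷ u) (y ∷ v) = ≡.cong₂ _∷_ (ℕₚ.m+n∸m≡n x y) (u·v÷u u v)

·-assoc : ∀ (u v w : Monomial n) → (u · v) · w ≡ u · (v · w)
·-assoc = Vecₚ.zipWith-assoc ℕₚ.+-assoc

·-comm : ∀ (u v : Monomial n) → u · v ≡ v · u
·-comm = Vecₚ.zipWith-comm ℕₚ.+-comm

·-identityˡ : ∀ (u : Monomial n) → 𝟙 · u ≡ u
·-identityˡ = Vecₚ.zipWith-identityˡ ℕₚ.+-identityˡ

module Polynomials (A : CommutativeRing c ℓ) (n : ℕ) where

  open CommutativeRing A
  open RingProperties ring using (-0#≈0#; -‿distribˡ-*; -‿+-comm)
  open import Relation.Binary.Reasoning.Setoid setoid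
  open import Algebra.Properties.CommutativeSemigroup +-commutativeSemigroup
    using (interchange)
  open import Algebra.Properties.CommutativeSemigroup *-commutativeSemigroup
    using (x∙yz≈y∙xz) renaming (interchange to *-interchange)

  -- A formal sum of terms (coefficient , monomial); monomials may repeat and
  -- coefficients may vanish, which the equality _≈ₚ_ below takes care of.
  Polynomial : Set c
  Polynomial = List (Carrier × Monomial n)

  -- linear p φ is the value at p of the A-linear map sending u to φ u.
  linear : Polynomial → (Monomial n → Carrier) → Carrier
  linear []            φ = 0#
  linear ((a , u) ∷ p) φ = a * φ u + linear p φ

  δ : Monomial n → Monomial n → Carrier
  δ u v = if does (u ≟ₘ v) then 1# else 0#

  coefficient : Polynomial → Monomial n → Carrier
  coefficient p u = linear p (δ u)

  infix 4 _≈ₚ_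

  record _≈ₚ_ (p q : Polynomial) : Set ℓ where
    constructor mk
    field
      coefficient-≈ : ∀ u → coefficient p u ≈ coefficient q u

  open _≈ₚ_ public

  infixl 6 _+ₚ_
  infixl 7 _*ₚ_
  infix  8 -ₚ_

  _+ₚ_ : Polynomial → Polynomial → Polynomial
  _+ₚ_ = _++_

  _*ₚ_ : Polynomial → Polynomial → Polynomial
  _*ₚ_ = cartesianProductWith λ (a , u) (b , v) → a * b , u · v

  -ₚ_ : Polynomial → Polynomial
  -ₚ_ = map λ (a , u) → - a , u

  monomial : Monomial n → Polynomial
  monomial u = (1# , u) ∷ []

  0ₚ 1ₚ : Polynomial
  0ₚ = []
  1ₚ = monomial 𝟙

  Functional : Set c
  Functional = Monomial n → Carrier

  linear-cong : ∀ p {φ ψ : Functional} → (∀ u → φ u ≈ ψ u) → linear p φ ≈ linear p ψ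
  linear-cong []            eq = refl
  linear-cong ((a , u) ∷ p) eq = +-cong (*-congˡ (eq u)) (linear-cong p eq)

  linear-0 : ∀ p → linear p (λ _ → 0#) ≈ 0#
  linear-0 []            = refl
  linear-0 ((a , u) ∷ p) = trans (+-cong (zeroʳ a) (linear-0 p)) (+-identityˡ 0#)

  linear-+ : ∀ p (φ ψ : Functional) →
             linear p (λ u → φ u + ψ u) ≈ linear p φ + linear p ψ
  linear-+ []            φ ψ = sym (+-identityˡ 0#)
  linear-+ ((a , u) ∷ p) φ ψ =
    trans (+-cong (distribˡ a (φ u) (ψ u)) (linear-+ p φ ψ)) (interchange _ _ _ _)

  linear-* : ∀ p b (φ : Functional) → linear p (λ u → b * φ u) ≈ b * linear p φ
  linear-* []            b φ = sym (zeroʳ b)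
  linear-* ((a , u) ∷ p) b φ =
    trans (+-cong (x∙yz≈y∙xz a b (φ u)) (linear-* p b φ)) (sym (distribˡ b _ _))

  linear-++ : ∀ p q (φ : Functional) → linear (p ++ q) φ ≈ linear p φ + linear q φ
  linear-++ []      q φ = sym (+-identityˡ _)
  linear-++ (t ∷ p) q φ = trans (+-congˡ (linear-++ p q φ)) (sym (+-assoc _ _ _))

  linear-neg : ∀ p (φ : Functional) → linear (-ₚ p) φ ≈ - linear p φ
  linear-neg []            φ = sym -0#≈0#
  linear-neg ((a , u) ∷ p) φ =
    trans (+-cong (sym (-‿distribˡ-* a (φ u))) (linear-neg p φ)) (-‿+-comm _ _)

  linear-swap : ∀ p q (F : Monomial n → Monomial n → Carrier) →
    linear p (λ u → linear q (λ v → F u v)) ≈ linear q (λ v → linear p (λ u → F u v))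
  linear-swap []            q F = sym (linear-0 q)
  linear-swap ((a , u) ∷ p) q F = begin
    a * linear q (F u) + linear p (λ u → linear q (F u))
      ≈⟨ +-cong (sym (linear-* q a (F u))) (linear-swap p q F) ⟩
    linear q (λ v → a * F u v) + linear q (λ v → linear p (λ u → F u v))
      ≈⟨ linear-+ q _ _ ⟨
    linear q (λ v → a * F u v + linear p (λ u → F u v)) ∎

  linear-term : ∀ a u q (φ : Functional) →
    linear (map (λ (b , v) → a * b , u · v) q) φ ≈ a * linear q (λ v → φ (u · v))
  linear-term a u []            φ = sym (zeroʳ a)
  linear-term a u ((b , v) ∷ q) φ =
    trans (+-cong (*-assoc a b _) (linear-term a u q φ)) (sym (distribˡ a _ _))

  linear-product : ∀ p q (φ : Functional) →
    linear (p *ₚ q) φ ≈ linear p (λ u → linear q (λ v → φ (u · v)))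
  linear-product []            q φ = refl
  linear-product ((a , u) ∷ p) q φ =
    trans (linear-++ (map _ q) (p *ₚ q) φ)
          (+-cong (linear-term a u q φ) (linear-product p q φ))

  δ-≡ : ∀ {u v} → u ≡ v → δ u v ≈ 1#
  δ-≡ {u} {v} eq with u ≟ₘ v
  ... | yes _ = refl
  ... | no ne = contradiction eq ne

  δ-≢ : ∀ {u v} → u ≢ v → δ u v ≈ 0#
  δ-≢ {u} {v} ne with u ≟ₘ v
  ... | yes eq = contradiction eq ne
  ... | no _   = refl

  δ-shift : ∀ {u v w} → u · w ≡ v → ∀ x → δ v (u · x) ≈ δ w x
  δ-shift {u} {v} {w} eq x with w ≟ₘ x
  ... | yes w≡x = δ-≡ (≡.trans (≡.sym eq) (≡.cong (u ·_) w≡x))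
  ... | no  w≢x = δ-≢ λ v≡ux → w≢x (≡.trans (≡.sym (u·v÷u u w))
                    (≡.trans (≡.cong (_÷ u) (≡.trans eq v≡ux)) (u·v÷u u x)))

  linear-shift : ∀ {p q} → p ≈ₚ q → ∀ u v →
    linear p (λ x → δ v (u · x)) ≈ linear q (λ x → δ v (u · x))
  linear-shift {p} {q} p≈q u v with u · (v ÷ u) ≟ₘ v
  ... | yes eq = begin
    linear p (λ x → δ v (u · x)) ≈⟨ linear-cong p (δ-shift {u} eq) ⟩
    linear p (δ (v ÷ u))         ≈⟨ coefficient-≈ p≈q (v ÷ u) ⟩
    linear q (δ (v ÷ u))         ≈⟨ linear-cong q (δ-shift {u} eq) ⟨
    linear q (λ x → δ v (u · x)) ∎
  ... | no ne = trans (vanish p) (sym (vanish q))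
    where
    vanish : ∀ r → linear r (λ x → δ v (u · x)) ≈ 0#
    vanish r = trans (linear-cong r λ x → δ-≢ λ v≡ux → ne
      (≡.trans (≡.cong (u ·_) (≡.trans (≡.cong (_÷ u) v≡ux) (u·v÷u u x))) (≡.sym v≡ux)))
      (linear-0 r)

  *ₚ-comm : ∀ p q → p *ₚ q ≈ₚ q *ₚ p
  *ₚ-comm p q = mk λ w → begin
    linear (p *ₚ q) (δ w)                          ≈⟨ linear-product p q _ ⟩
    linear p (λ u → linear q (λ v → δ w (u · v)))  ≈⟨ linear-swap p q _ ⟩
    linear q (λ v → linear p (λ u → δ w (u · v)))
      ≈⟨ linear-cong q (λ v → linear-cong p λ u → reflexive (≡.cong (δ w) (·-comm u v))) ⟩
    linear q (λ v → linear p (λ u → δ w (v · u)))  ≈⟨ linear-product q p _ ⟨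
    linear (q *ₚ p) (δ w) ∎

  *ₚ-assoc : ∀ p q r → (p *ₚ q) *ₚ r ≈ₚ p *ₚ (q *ₚ r)
  *ₚ-assoc p q r = mk λ w → begin
    linear ((p *ₚ q) *ₚ r) (δ w)  ≈⟨ linear-product (p *ₚ q) r _ ⟩
    linear (p *ₚ q) (λ x → linear r (λ y → δ w (x · y)))  ≈⟨ linear-product p q _ ⟩
    linear p (λ u → linear q (λ v → linear r (λ y → δ w ((u · v) · y))))
      ≈⟨ linear-cong p (λ u → linear-cong q λ v → linear-cong r λ y →
           reflexive (≡.cong (δ w) (·-assoc u v y))) ⟩
    linear p (λ u → linear q (λ v → linear r (λ y → δ w (u · (v · y)))))
      ≈⟨ linear-cong p (λ u → linear-product q r _) ⟨
    linear p (λ u → linear (q *ₚ r) (λ x → δ w (u · x)))  ≈⟨ linear-product p (q *ₚ r) _ ⟨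
    linear (p *ₚ (q *ₚ r)) (δ w) ∎

  ≈ₚ-trans : ∀ {p q r} → p ≈ₚ q → q ≈ₚ r → p ≈ₚ r
  ≈ₚ-trans e f = mk λ u → trans (coefficient-≈ e u) (coefficient-≈ f u)

  *ₚ-congˡ : ∀ p {q r} → q ≈ₚ r → p *ₚ q ≈ₚ p *ₚ r
  *ₚ-congˡ p {q} {r} eq = mk λ w → begin
    linear (p *ₚ q) (δ w)                          ≈⟨ linear-product p q _ ⟩
    linear p (λ u → linear q (λ v → δ w (u · v)))
      ≈⟨ linear-cong p (λ u → linear-shift eq u w) ⟩
    linear p (λ u → linear r (λ v → δ w (u · v)))  ≈⟨ linear-product p r _ ⟨
    linear (p *ₚ r) (δ w) ∎

  *ₚ-cong : ∀ {p p′ q q′} → p ≈ₚ p′ → q ≈ₚ q′ → p *ₚ q ≈ₚ p′ *ₚ q′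
  *ₚ-cong {p} {p′} {q} {q′} e f =
    ≈ₚ-trans (*ₚ-congˡ p f) (≈ₚ-trans (*ₚ-comm p q′)
      (≈ₚ-trans (*ₚ-congˡ q′ e) (*ₚ-comm q′ p′)))

  *ₚ-identityˡ : ∀ p → 1ₚ *ₚ p ≈ₚ p
  *ₚ-identityˡ p = mk λ w → begin
    linear (1ₚ *ₚ p) (δ w)                     ≈⟨ linear-product 1ₚ p _ ⟩
    1# * linear p (λ v → δ w (𝟙 · v)) + 0#     ≈⟨ +-identityʳ _ ⟩
    1# * linear p (λ v → δ w (𝟙 · v))          ≈⟨ *-identityˡ _ ⟩
    linear p (λ v → δ w (𝟙 · v))
      ≈⟨ linear-cong p (λ v → reflexive (≡.cong (δ w) (·-identityˡ v))) ⟩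
    linear p (δ w) ∎

  *ₚ-distribʳ : ∀ p q r → (q +ₚ r) *ₚ p ≈ₚ q *ₚ p +ₚ r *ₚ p
  *ₚ-distribʳ p q r = mk λ w → begin
    linear ((q ++ r) *ₚ p) (δ w)  ≈⟨ linear-product (q ++ r) p _ ⟩
    linear (q ++ r) _             ≈⟨ linear-++ q r _ ⟩
    linear q _ + linear r _       ≈⟨ +-cong (linear-product q p _) (linear-product r p _) ⟨
    linear (q *ₚ p) (δ w) + linear (r *ₚ p) (δ w)  ≈⟨ linear-++ (q *ₚ p) _ _ ⟨
    linear (q *ₚ p ++ r *ₚ p) (δ w) ∎

  +ₚ-cong : ∀ {p p′ q q′} → p ≈ₚ p′ → q ≈ₚ q′ → p +ₚ q ≈ₚ p′ +ₚ q′
  +ₚ-cong {p} {p′} {q} {q′} e f = mk λ u → begin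
    linear (p ++ q) (δ u)              ≈⟨ linear-++ p q _ ⟩
    linear p (δ u) + linear q (δ u)    ≈⟨ +-cong (coefficient-≈ e u) (coefficient-≈ f u) ⟩
    linear p′ (δ u) + linear q′ (δ u)  ≈⟨ linear-++ p′ q′ _ ⟨
    linear (p′ ++ q′) (δ u) ∎

  +ₚ-assoc : ∀ p q r → (p +ₚ q) +ₚ r ≈ₚ p +ₚ (q +ₚ r)
  +ₚ-assoc p q r = mk λ u → begin
    linear ((p ++ q) ++ r) (δ u)  ≈⟨ linear-++ (p ++ q) r _ ⟩
    linear (p ++ q) (δ u) + linear r (δ u)  ≈⟨ +-congʳ (linear-++ p q _) ⟩
    linear p (δ u) + linear q (δ u) + linear r (δ u)  ≈⟨ +-assoc _ _ _ ⟩
    linear p (δ u) + (linear q (δ u) + linear r (δ u))  ≈⟨ +-congˡ (linear-++ q r _) ⟨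
    linear p (δ u) + linear (q ++ r) (δ u)  ≈⟨ linear-++ p (q ++ r) _ ⟨
    linear (p ++ (q ++ r)) (δ u) ∎

  +ₚ-comm : ∀ p q → p +ₚ q ≈ₚ q +ₚ p
  +ₚ-comm p q = mk λ u →
    trans (linear-++ p q _) (trans (+-comm _ _) (sym (linear-++ q p _)))

  +ₚ-identityʳ : ∀ p → p +ₚ 0ₚ ≈ₚ p
  +ₚ-identityʳ p = mk λ u → trans (linear-++ p [] _) (+-identityʳ _)

  -ₚ-inverseˡ : ∀ p → -ₚ p +ₚ p ≈ₚ 0ₚ
  -ₚ-inverseˡ p = mk λ u →
    trans (linear-++ (-ₚ p) p _) (trans (+-congʳ (linear-neg p _)) (-‿inverseˡ _))

  -ₚ-cong : ∀ {p q} → p ≈ₚ q → -ₚ p ≈ₚ -ₚ q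
  -ₚ-cong {p} {q} e = mk λ u →
    trans (linear-neg p _) (trans (-‿cong (coefficient-≈ e u)) (sym (linear-neg q _)))

  polynomialRing : CommutativeRing c ℓ
  polynomialRing = record
    { Carrier = Polynomial
    ; _≈_ = _≈ₚ_
    ; _+_ = _+ₚ_
    ; _*_ = _*ₚ_
    ; -_  = -ₚ_
    ; 0#  = 0ₚ
    ; 1#  = 1ₚ
    ; isCommutativeRing = record
      { isRing = record
        { +-isAbelianGroup = record
          { isGroup = record
            { isMonoid = record
              { isSemigroup = record
                { isMagma = record
                  { isEquivalence = record
                    { refl  = mk λ _ → refl
                    ; sym   = λ e → mk λ u → sym (coefficient-≈ e u)
                    ; trans = ≈ₚ-trans
                    }
                  ; ∙-cong = +ₚ-cong
                  }
                ; assoc = +ₚ-assoc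
                }
              ; identity = (λ _ → mk λ _ → refl) , +ₚ-identityʳ
              }
            ; inverse = -ₚ-inverseˡ , λ p → ≈ₚ-trans (+ₚ-comm p (-ₚ p)) (-ₚ-inverseˡ p)
            ; ⁻¹-cong = -ₚ-cong
            }
          ; comm = +ₚ-comm
          }
        ; *-cong = *ₚ-cong
        ; *-assoc = *ₚ-assoc
        ; *-identity = *ₚ-identityˡ ,
            λ p → ≈ₚ-trans (*ₚ-comm p 1ₚ) (*ₚ-identityˡ p)
        ; distrib =
            (λ p q r → ≈ₚ-trans (*ₚ-comm p (q +ₚ r)) (≈ₚ-trans (*ₚ-distribʳ p q r)
              (+ₚ-cong (*ₚ-comm q p) (*ₚ-comm r p))))
            , *ₚ-distribʳ
        }
      ; *-comm = *ₚ-comm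
      }
    }

module Ideals (R : CommutativeRing c ℓ) where

  open CommutativeRing R using (Carrier; _≈_; _+_; _*_; 0#)

  data ⟨_⟩ {J : Set i} (g : J → Carrier) : Pred Carrier (c ⊔ ℓ ⊔ i) where
    generator : ∀ j → ⟨ g ⟩ (g j)
    zero      : ⟨ g ⟩ 0#
    add       : ∀ {r s} → ⟨ g ⟩ r → ⟨ g ⟩ s → ⟨ g ⟩ (r + s)
    scale     : ∀ r {s} → ⟨ g ⟩ s → ⟨ g ⟩ (r * s)
    resp      : ∀ {r s} → r ≈ s → ⟨ g ⟩ r → ⟨ g ⟩ s

  infix 5 _∶_

  _∶_ : Pred Carrier i → Carrier → Pred Carrier i
  (I ∶ a) r = I (r * a)

-- The library's fields are Heyting fields; classically (with _#_ the negation
-- of _≈_) they are exactly the fields.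
module OverField {c ℓ₁ ℓ₂} (𝕂 : HeytingField c ℓ₁ ℓ₂) (n : ℕ) where

  𝕂-commutativeRing : CommutativeRing c ℓ₁
  𝕂-commutativeRing =
    HeytingCommutativeRing.commutativeRing (HeytingField.heytingCommutativeRing 𝕂)

  open Polynomials 𝕂-commutativeRing n public
  open Ideals polynomialRing public

  𝐱 : Subset n → Polynomial
  𝐱 e = monomial (squarefree e)

  x : Fin n → Polynomial
  x i = 𝐱 ⁅ i ⁆

  circuitIdeal : Clutter d n → Pred Polynomial (c ⊔ ℓ₁)
  circuitIdeal D = ⟨ (λ (f : ∃ (Circuit D)) → 𝐱 (proj₁ f)) ⟩

  variableIdeal : Subset n → Pred Polynomial (c ⊔ ℓ₁)
  variableIdeal S = ⟨ (λ (i : ∃ (_∈ S)) → x (proj₁ i)) ⟩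

  IsMonomialIdeal : Pred Polynomial (c ⊔ ℓ₁) → Set (lsuc 0ℓ ⊔ c ⊔ ℓ₁)
  IsMonomialIdeal I =
    Σ (Pred (Monomial n) 0ℓ) λ M → I ≐ ⟨ (λ (u : ∃ M) → monomial (proj₁ u)) ⟩

  -- The generators of a monomial ideal are the elements of its unique minimal
  -- set of monomial generators: the monomials of I minimal under divisibility.
  IsGenerator : Pred Polynomial (c ⊔ ℓ₁) → Pred (Monomial n) (c ⊔ ℓ₁)
  IsGenerator I u =
    I (monomial u) × (∀ v → I (monomial v) → v ∣ₘ u → v ≡ u)

  record IsLinearDivisor (I : Pred Polynomial (c ⊔ ℓ₁)) (e : Subset n)
         : Set (lsuc 0ℓ ⊔ c ⊔ ℓ₁) where
    field
      monomialIdeal : IsMonomialIdeal I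
      notGenerator  : ¬ IsGenerator I (squarefree e)
      colonLinear   : ∃ λ S → (I ∶ 𝐱 e) ≐ variableIdeal S

{-# OPTIONS --safe #-}
-- A squarefree monomial ideal is determined by the monomials it contains: a
-- polynomial lies in it exactly when its coefficient vanishes at every monomial
-- whose support contains the support of no generator.  The equality
-- (I : x_e) = ⟨x_i : i ∉ K⟩ therefore says that, for every S ⊆ [n], S ∪ e
-- contains a non-circuit of size d iff S ⊈ K.  As e is a circuit, the sets
-- S ∪ e without non-circuits are the cliques containing e, and since every
-- clique extends to a maximal one, this means that K is the unique maximal
-- clique containing e.
module Submission where

open import Defs
open import Algebra.Apartness.Bundles using (HeytingField)
open import Data.Fin.Subset using (Subset; ∁)
open import Data.Nat.Base using (ℕ; _≤_)
open import Data.Product.Base using (_×_)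
open import Function.Bundles using (_⇔_)
open import Relation.Unary using (_≐_)

open import Level using (Level)
import Algebra.Apartness.Properties.HeytingCommutativeRing as HeytingProperties
open import Algebra.Bundles using (CommutativeRing)
open import Data.Bool.Base using (true; false)
open import Data.Fin.Subset using (_∈_; _⊆_; _⊃_; _∪_; _∩_; ∣_∣; ⁅_⁆; Nonempty)
open import Data.Fin.Subset.Induction using (⊃-wellFounded; Acc; acc)
open import Data.Fin.Subset.Properties as Subsetₚ
  using (_∈?_; _⊆?_; _⊂?_; anySubset?; nonempty?; ⊆-refl; ⊆-trans; ⊆-antisym)
open import Data.List.Base using ([]; _∷_; filter)
open import Data.Nat.Base using (zero; suc; _<ᵇ_)
import Data.Nat.Properties as ℕₚ
open import Data.Product.Base using (∃; _,_; proj₁; proj₂)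
open import Data.Sum.Base using (inj₁; inj₂; [_,_]′)
open import Data.Vec.Base as Vec using ([]; _∷_)
open import Function.Base using (_∘_; id)
open import Function.Bundles using (mk⇔; Equivalence)
open import Relation.Binary.PropositionalEquality as ≡ using (_≡_)
open import Relation.Nullary.Decidable as Dec
  using (yes; no; ¬?; _×-dec_; decidable-stable)
open import Relation.Nullary.Negation using (¬_)
open import Relation.Unary using (Pred; Decidable)

private
  variable
    c ℓ i j : Level
    d n : ℕ

-- Supports of monomials and divisibility by squarefree monomials.

ContainsSome : {J : Set i} → (J → Subset n) → Subset n → Set i
ContainsSome s S = ∃ λ j → s j ⊆ S

module _ {J : Set i} {s : J → Subset n} where

  containsSome-mono : ∀ {S T} → S ⊆ T → ContainsSome s S → ContainsSome s T
  containsSome-mono S⊆T (j , sj⊆S) = j , ⊆-trans sj⊆S S⊆T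

  containsSome-resp : ∀ {S T} → S ≡ T → ContainsSome s S → ContainsSome s T
  containsSome-resp ≡.refl = id

support : Monomial n → Subset n
support = Vec.map (0 <ᵇ_)

support-· : ∀ (u v : Monomial n) → support (u · v) ≡ support u ∪ support v
support-· []          []      = ≡.refl
support-· (zero  ∷ u) (y ∷ v) = ≡.cong (_ ∷_) (support-· u v)
support-· (suc x ∷ u) (y ∷ v) = ≡.cong (_ ∷_) (support-· u v)

support-squarefree : ∀ (f : Subset n) → support (squarefree f) ≡ f
support-squarefree []          = ≡.refl
support-squarefree (true  ∷ f) = ≡.cong (true ∷_) (support-squarefree f)
support-squarefree (false ∷ f) = ≡.cong (false ∷_) (support-squarefree f)

support-·-squarefree : ∀ (u : Monomial n) f →
                       support (u · squarefree f) ≡ support u ∪ f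
support-·-squarefree u f =
  ≡.trans (support-· u _) (≡.cong (support u ∪_) (support-squarefree f))

-- The exponents of `squarefree f` are at most 1, so at each vertex of `f` a positive exponent of
-- `u` suffices.
⊆support⇒squarefree∣ : ∀ {f} {u : Monomial n} → f ⊆ support u → squarefree f ∣ₘ u
⊆support⇒squarefree∣ {f = []} {[]} _ = [] , ≡.refl
⊆support⇒squarefree∣ {f = false ∷ f} {x ∷ u} f⊆ =
  let w , eq = ⊆support⇒squarefree∣ (Subsetₚ.drop-∷-⊆ f⊆) in x ∷ w , ≡.cong (x ∷_) eq
⊆support⇒squarefree∣ {f = true ∷ f} {suc x ∷ u} f⊆ =
  let w , eq = ⊆support⇒squarefree∣ (Subsetₚ.drop-∷-⊆ f⊆) in x ∷ w , ≡.cong (suc x ∷_) eq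
⊆support⇒squarefree∣ {f = true ∷ f} {zero ∷ u} f⊆ with () ← f⊆ Vec.here

-- Membership in squarefree monomial ideals and their colon ideals.

module _ (R : CommutativeRing c ℓ) where
  open CommutativeRing R using (Carrier)
  open Ideals R

  ⟨⟩-least : {J : Set i} {J′ : Set j} {g : J → Carrier} {h : J′ → Carrier} →
             (∀ j → ⟨ h ⟩ (g j)) → ∀ {r} → ⟨ g ⟩ r → ⟨ h ⟩ r
  ⟨⟩-least g⊆h (generator j) = g⊆h j
  ⟨⟩-least g⊆h zero          = zero
  ⟨⟩-least g⊆h (add p q)     = add (⟨⟩-least g⊆h p) (⟨⟩-least g⊆h q)
  ⟨⟩-least g⊆h (scale r p)   = scale r (⟨⟩-least g⊆h p)
  ⟨⟩-least g⊆h (resp eq p)   = resp eq (⟨⟩-least g⊆h p)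

module SquarefreeMonomialIdeals
  (A : CommutativeRing c ℓ) (n : ℕ)
  (1≉0 : ¬ CommutativeRing._≈_ A (CommutativeRing.1# A) (CommutativeRing.0# A)) where

  open CommutativeRing A hiding (zero)
  open Polynomials A n
  open Ideals polynomialRing
  open import Relation.Binary.Reasoning.Setoid setoid

  private
    module P = CommutativeRing polynomialRing

  -- The sum is the coefficient of `v` in `u` times `p`: the coefficient of `p` at the quotient if
  -- `u` divides `v`, and 0 otherwise.
  linear-δ-· : ∀ p u v → (∀ w → u · w ≡ v → coefficient p w ≈ 0#) →
               linear p (λ w → δ v (u · w)) ≈ 0#
  -- As `÷` truncates, this equation holds exactly when `u` divides `v`.
  linear-δ-· p u v vanish with u · (v ÷ u) ≟ₘ v
  ... | yes eq = trans (linear-cong p (δ-shift {u} eq)) (vanish (v ÷ u) eq)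
  ... | no  ne = trans (linear-cong p λ w → δ-≢ λ v≡uw → ne
    (≡.trans (≡.cong (u ·_) (≡.trans (≡.cong (_÷ u) v≡uw) (u·v÷u u w))) (≡.sym v≡uw)))
    (linear-0 p)

  coefficient-*-monomial : ∀ p v w →
    coefficient (p *ₚ monomial v) w ≈ linear p (λ u → δ w (v · u))
  coefficient-*-monomial p v w = begin
    coefficient (p *ₚ monomial v) w                ≈⟨ linear-product p (monomial v) _ ⟩
    linear p (λ u → 1# * δ w (u · v) + 0#)
      ≈⟨ linear-cong p (λ u → trans (+-identityʳ _) (trans (*-identityˡ _)
           (reflexive (≡.cong (δ w) (·-comm u v))))) ⟩
    linear p (λ u → δ w (v · u))                   ∎

  coefficient-*-monomial-· : ∀ p u v →
    coefficient (p *ₚ monomial v) (u · v) ≈ coefficient p u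
  coefficient-*-monomial-· p u v =
    trans (coefficient-*-monomial p v (u · v)) (linear-cong p (δ-shift {v} (·-comm v u)))

  coefficient-monomial : ∀ u → coefficient (monomial u) u ≈ 1#
  coefficient-monomial u =
    trans (+-identityʳ _) (trans (*-identityˡ _) (δ-≡ {u} ≡.refl))

  monomial-·≈* : ∀ u v → monomial (u · v) ≈ₚ monomial u *ₚ monomial v
  monomial-·≈* u v = mk λ _ → +-congʳ (*-congʳ (sym (*-identityˡ 1#)))

  linear-filter : ∀ {P : Pred (Monomial n) i} (P? : Decidable P) {φ} →
                  (∀ u → ¬ P u → φ u ≈ 0#) →
                  ∀ p → linear (filter (P? ∘ proj₂) p) φ ≈ linear p φ
  linear-filter P? φ≈0 [] = refl
  linear-filter P? {φ} φ≈0 ((a , u) ∷ p) with P? u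
  ... | yes _ = +-congˡ (linear-filter P? φ≈0 p)
  ... | no ¬Pu = trans (linear-filter P? φ≈0 p) (trans (sym (+-identityˡ _))
    (+-congʳ (sym (trans (*-congˡ (φ≈0 u ¬Pu)) (zeroʳ a)))))

  module _ {J : Set i} {s : J → Subset n} where

    private
      generators : J → Polynomial
      generators j = monomial (squarefree (s j))

    -- The polynomials whose coefficients vanish at all these monomials form an ideal that contains
    -- the generators.
    ideal⇒coefficient≈0 : ∀ {r} → ⟨ generators ⟩ r →
      ∀ u → ¬ ContainsSome s (support u) → coefficient r u ≈ 0#
    ideal⇒coefficient≈0 (generator j) u ¬s = trans (+-identityʳ _)
      (trans (*-congˡ (δ-≢ {u} {squarefree (s j)} λ { ≡.refl →
        ¬s (j , Subsetₚ.⊆-reflexive (≡.sym (support-squarefree (s j)))) })) (zeroʳ _))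
    ideal⇒coefficient≈0 zero u ¬s = refl
    ideal⇒coefficient≈0 (add {r} {r′} p q) u ¬s = trans (linear-++ r r′ (δ u))
      (trans (+-cong (ideal⇒coefficient≈0 p u ¬s) (ideal⇒coefficient≈0 q u ¬s))
        (+-identityˡ 0#))
    -- If `u` is `v · w`, the support of `w` lies in that of `u`, so it contains no `s j` either.
    ideal⇒coefficient≈0 (scale r {r′} p) u ¬s = trans (linear-product r r′ (δ u))
      (trans (linear-cong r λ v → linear-δ-· r′ v u λ { w ≡.refl →
        ideal⇒coefficient≈0 p w (¬s ∘ containsSome-resp (≡.sym (support-· v w))
          ∘ containsSome-mono (Subsetₚ.q⊆p∪q (support v) (support w))) })
        (linear-0 r))
    ideal⇒coefficient≈0 (resp eq p) u ¬s =
      trans (sym (coefficient-≈ eq u)) (ideal⇒coefficient≈0 p u ¬s)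

    term∈ideal : ∀ a u → ContainsSome s (support u) → ⟨ generators ⟩ ((a , u) ∷ [])
    term∈ideal a u (j , sj⊆u) = resp
      (mk λ v → +-congʳ (*-cong (*-identityʳ a)
        (reflexive (≡.cong (δ v) (≡.trans (·-comm w _) eq)))))
      (scale ((a , w) ∷ []) (generator j))
      where
      w = proj₁ (⊆support⇒squarefree∣ {u = u} sj⊆u)
      eq = proj₂ (⊆support⇒squarefree∣ {u = u} sj⊆u)

    module _ (s? : Decidable (ContainsSome s)) where

      private
        divisible? : Decidable (ContainsSome s ∘ support)
        divisible? u = s? (support u)

      filter∈ideal : ∀ r → ⟨ generators ⟩ (filter (divisible? ∘ proj₂) r)
      filter∈ideal [] = zero
      filter∈ideal ((a , u) ∷ r) with divisible? u
      ... | yes su = add (term∈ideal a u su) (filter∈ideal r)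
      ... | no  _  = filter∈ideal r

      -- Vanishing of coefficients need not be decidable, and terms of `r` may cancel. Hence `r` is
      -- compared with the sum of its terms that are divisible by a generator: this sum lies in the
      -- ideal and turns out to equal `r`.
      coefficient≈0⇒ideal : ∀ {r} →
        (∀ u → ¬ ContainsSome s (support u) → coefficient r u ≈ 0#) → ⟨ generators ⟩ r
      coefficient≈0⇒ideal {r} vanish = resp (mk same) (filter∈ideal r)
        where
        same : ∀ u → coefficient (filter (divisible? ∘ proj₂) r) u ≈ coefficient r u
        -- At a divisible `u` the discarded terms contribute nothing; at any other `u` both
        -- coefficients vanish.
        same u with divisible? u
        ... | yes su = linear-filter divisible?
                         (λ v ¬sv → δ-≢ {u} {v} λ { ≡.refl → ¬sv su }) r
        ... | no ¬su = trans (ideal⇒coefficient≈0 (filter∈ideal r) u ¬su)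
                         (sym (vanish u ¬su))

      -- Otherwise the coefficient of `u` in itself, which is 1, would vanish.
      monomial∈ideal⇒containsSome : ∀ {u} → ⟨ generators ⟩ (monomial u) →
                                    ContainsSome s (support u)
      monomial∈ideal⇒containsSome {u} p = decidable-stable (divisible? u) λ ¬su →
        1≉0 (trans (sym (coefficient-monomial u)) (ideal⇒coefficient≈0 p u ¬su))

  module _ {J : Set i} {s : J → Subset n} (s? : Decidable (ContainsSome s))
           {J′ : Set j} {t : J′ → Subset n} (t? : Decidable (ContainsSome t))
           (e : Subset n) where

    private
      I = ⟨ (λ j → monomial (squarefree (s j))) ⟩
      I′ = ⟨ (λ j → monomial (squarefree (t j))) ⟩
      xₑ = monomial (squarefree e)

    -- From left to right the ideals are tested on squarefree monomials; conversely, the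
    -- coefficients of `r` and of `r *ₚ xₑ` are matched by the shift from `u` to `u · squarefree e`.
    colon≐ideal⇔ : ((I ∶ xₑ) ≐ I′) ⇔ (∀ S → ContainsSome s (S ∪ e) ⇔ ContainsSome t S)
    colon≐ideal⇔ = mk⇔ to from
      where
      to : (I ∶ xₑ) ≐ I′ → ∀ S → ContainsSome s (S ∪ e) ⇔ ContainsSome t S
      to (⊆I′ , ⊇I′) S = mk⇔
        (λ sSe → containsSome-resp (support-squarefree S)
          (monomial∈ideal⇒containsSome t? (⊆I′ (resp (monomial-·≈* (squarefree S) _)
            (term∈ideal 1# _ (containsSome-resp (≡.sym supportSe) sSe))))))
        (λ tS → containsSome-resp supportSe (monomial∈ideal⇒containsSome s?
          (resp (P.sym (monomial-·≈* (squarefree S) _))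
            (⊇I′ (term∈ideal 1# _
              (containsSome-resp (≡.sym (support-squarefree S)) tS))))))
        where
        -- The product has exponents 2 where `S` meets `e`, but only its support matters.
        supportSe : support (squarefree S · squarefree e) ≡ S ∪ e
        supportSe = ≡.trans (support-·-squarefree (squarefree S) e)
          (≡.cong (_∪ e) (support-squarefree S))

      from : (∀ S → ContainsSome s (S ∪ e) ⇔ ContainsSome t S) → (I ∶ xₑ) ≐ I′
      from s⇔t = ⊆I′ , ⊇I′
        where
        ⊆I′ : ∀ {r} → (I ∶ xₑ) r → I′ r
        ⊆I′ {r} p = coefficient≈0⇒ideal t? λ u ¬tu →
          trans (sym (coefficient-*-monomial-· r u (squarefree e)))
            (ideal⇒coefficient≈0 p _ (¬tu ∘ Equivalence.to (s⇔t (support u))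
              ∘ containsSome-resp (support-·-squarefree u e)))

        ⊇I′ : ∀ {r} → I′ r → (I ∶ xₑ) r
        -- Here `w` need not be a multiple of `squarefree e`; if it is not, `linear-δ-·` gives
        -- coefficient 0.
        ⊇I′ {r} p = coefficient≈0⇒ideal s? λ w ¬sw →
          trans (coefficient-*-monomial r (squarefree e) w)
            (linear-δ-· r _ w λ { u ≡.refl → ideal⇒coefficient≈0 p u
              (¬sw ∘ containsSome-resp (≡.trans (≡.sym (support-·-squarefree u e))
                (≡.cong support (·-comm u _))) ∘ Equivalence.from (s⇔t (support u))) })

-- Circuits and single vertices as generating families.

circuits : (D : Clutter d n) → ∃ (Circuit D) → Subset n
circuits D = proj₁

containsCircuit? : (D : Clutter d n) → Decidable (ContainsSome (circuits D))
containsCircuit? D S = Dec.map′ {A = ∃ λ f → Circuit D f × f ⊆ S}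
  (λ (f , Df , f⊆S) → (f , Df) , f⊆S)
  (λ ((f , Df) , f⊆S) → f , Df , f⊆S)
  (anySubset? λ f → circuit? D f ×-dec (f ⊆? S))

-- The squarefree monomials of this family are the variables that generate `variableIdeal S`, so the
-- results on squarefree monomial ideals cover variable ideals.
singletons : (S : Subset n) → ∃ (_∈ S) → Subset n
singletons S = ⁅_⁆ ∘ proj₁

containsSingleton : ∀ {S T : Subset n} {x} → x ∈ S → x ∈ T →
                    ContainsSome (singletons S) T
containsSingleton {x = x} x∈S x∈T =
  (x , x∈S) , λ y∈⁅x⁆ → ≡.subst (_∈ _) (≡.sym (Subsetₚ.x∈⁅y⁆⇒x≡y x y∈⁅x⁆)) x∈T

containsSingleton? : (S : Subset n) → Decidable (ContainsSome (singletons S))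
containsSingleton? S T = Dec.map′
  (λ (x , x∈S∩T) → let x∈S , x∈T = Subsetₚ.x∈p∩q⁻ S T x∈S∩T in containsSingleton x∈S x∈T)
  (λ ((x , x∈S) , ⁅x⁆⊆T) → x , Subsetₚ.x∈p∩q⁺ (x∈S , ⁅x⁆⊆T (Subsetₚ.x∈⁅x⁆ x)))
  (nonempty? (S ∩ T))

containsSingleton-∁⇒⊈ : ∀ {K S : Subset n} → ContainsSome (singletons (∁ K)) S → ¬ S ⊆ K
containsSingleton-∁⇒⊈ ((x , x∈∁K) , ⁅x⁆⊆S) S⊆K =
  Subsetₚ.x∈∁p⇒x∉p x∈∁K (S⊆K (⁅x⁆⊆S (Subsetₚ.x∈⁅x⁆ x)))

¬containsSingleton-∁⇒⊆ : ∀ {K S : Subset n} → ¬ ContainsSome (singletons (∁ K)) S → S ⊆ K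
¬containsSingleton-∁⇒⊆ none x∈S =
  Subsetₚ.x∉∁p⇒x∈p λ x∈∁K → none (containsSingleton x∈∁K x∈S)

∪-lub : ∀ {S T U : Subset n} → S ⊆ U → T ⊆ U → S ∪ T ⊆ U
∪-lub {S = S} {T} S⊆U T⊆U x∈S∪T = [ S⊆U , T⊆U ]′ (Subsetₚ.x∈p∪q⁻ S T x∈S∪T)

⊆∧∣≡∣⇒≡ : ∀ {S T : Subset n} → S ⊆ T → ∣ S ∣ ≡ ∣ T ∣ → S ≡ T
⊆∧∣≡∣⇒≡ {S = S} S⊆T eq = ⊆-antisym S⊆T λ {x} x∈T →
  decidable-stable (x ∈? S) λ x∉S →
    ℕₚ.<⇒≢ (Subsetₚ.p⊂q⇒∣p∣<∣q∣ (S⊆T , x , x∈T , x∉S)) eq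

1≤∣∣⇒nonempty : ∀ {S : Subset n} → 1 ≤ ∣ S ∣ → Nonempty S
1≤∣∣⇒nonempty {n} {S} 1≤∣S∣ = decidable-stable (nonempty? S) λ empty →
  ℕₚ.<⇒≢ 1≤∣S∣ (≡.sym (≡.trans (≡.cong ∣_∣ (Subsetₚ.Empty-unique empty)) (Subsetₚ.∣⊥∣≡0 n)))

-- Cliques containing a fixed circuit.

module _ (C : Clutter d n) (1≤d : 1 ≤ d) {e : Subset n} (e∈C : Circuit C e) where

  private
    ContainsNonCircuit = ContainsSome (circuits (complement C))

  -- Excludes the alternative `∣ S ∣ < d` in the definition of a clique.
  d≤∣_∣ : ∀ S → e ⊆ S → d ≤ ∣ S ∣
  d≤∣ S ∣ e⊆S = ≡.subst (_≤ ∣ S ∣) (uniform C e∈C) (Subsetₚ.p⊆q⇒∣p∣≤∣q∣ e⊆S)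

  -- The only `d`-subset of `e` is `e` itself.
  ¬containsNonCircuit-circuit : ¬ ContainsNonCircuit e
  ¬containsNonCircuit-circuit ((f , ∣f∣≡d , f∉C) , f⊆e) =
    f∉C (≡.subst (Circuit C) (≡.sym (⊆∧∣≡∣⇒≡ f⊆e (≡.trans ∣f∣≡d (≡.sym (uniform C e∈C))))) e∈C)

  clique⇒¬containsNonCircuit : ∀ {S} → e ⊆ S → IsClique C S → ¬ ContainsNonCircuit S
  clique⇒¬containsNonCircuit {S} e⊆S (_ , inj₁ ∣S∣<d) _ = ℕₚ.<⇒≱ ∣S∣<d (d≤∣ S ∣ e⊆S)
  clique⇒¬containsNonCircuit e⊆S (_ , inj₂ (_ , all)) ((f , ∣f∣≡d , f∉C) , f⊆S) =
    f∉C (all f f⊆S ∣f∣≡d)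

  ¬containsNonCircuit⇒clique : ∀ {S} → e ⊆ S → ¬ ContainsNonCircuit S → IsClique C S
  ¬containsNonCircuit⇒clique {S} e⊆S none =
    1≤∣∣⇒nonempty (ℕₚ.≤-trans 1≤d (d≤∣ S ∣ e⊆S)) ,
    inj₂ (d≤∣ S ∣ e⊆S , λ f f⊆S ∣f∣≡d →
      decidable-stable (circuit? C f) λ f∉C → none ((f , ∣f∣≡d , f∉C) , f⊆S))

  -- Well-founded induction on strict supersets: a search over all subsets finds a larger set
  -- without non-circuits or shows that `S` is maximal.
  extendToMaximalClique : ∀ S → e ⊆ S → ¬ ContainsNonCircuit S →
                          ∃ λ T → IsMaximalClique C T × S ⊆ T
  extendToMaximalClique S = go (⊃-wellFounded S)
    where
    go : ∀ {S} → Acc _⊃_ S → e ⊆ S → ¬ ContainsNonCircuit S →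
         ∃ λ T → IsMaximalClique C T × S ⊆ T
    go {S} (acc rec) e⊆S none
      with anySubset? (λ T → (S ⊂? T) ×-dec ¬? (containsCircuit? (complement C) T))
    ... | yes (T , S⊂T@(S⊆T , _) , none′) =
      let U , maximal , T⊆U = go (rec S⊂T) (⊆-trans e⊆S S⊆T) none′
      in  U , maximal , ⊆-trans S⊆T T⊆U
    ... | no largest = S , (¬containsNonCircuit⇒clique e⊆S none , maximal) , ⊆-refl
      where
      maximal : ∀ T → IsClique C T → S ⊆ T → T ≡ S
      maximal T clique S⊆T = ⊆-antisym (λ {x} x∈T → decidable-stable (x ∈? S) λ x∉S →
        largest (T , (S⊆T , x , x∈T , x∉S) ,
          clique⇒¬containsNonCircuit (⊆-trans e⊆S S⊆T) clique)) S⊆T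

  uniqueMaximalClique⇔ : ∀ K → IsUniqueMaximalCliqueContaining C e K ⇔
    (∀ S → ContainsNonCircuit (S ∪ e) ⇔ ContainsSome (singletons (∁ K)) S)
  uniqueMaximalClique⇔ K = mk⇔ to from
    where
    to : IsUniqueMaximalCliqueContaining C e K →
         ∀ S → ContainsNonCircuit (S ∪ e) ⇔ ContainsSome (singletons (∁ K)) S
    to (((cliqueK , _) , e⊆K) , unique) S = mk⇔
      -- If `S` were inside `K`, the non-circuit in `S ∪ e` would lie in the clique `K`.
      (λ nonCircuit → decidable-stable (containsSingleton? (∁ K) S) λ none →
        clique⇒¬containsNonCircuit e⊆K cliqueK
          (containsSome-mono (∪-lub (¬containsSingleton-∁⇒⊆ none) e⊆K) nonCircuit))
      -- Without a non-circuit, `S ∪ e` would extend to a maximal clique, which is `K` by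
      -- uniqueness, forcing `S ⊆ K`.
      (λ outsideK → decidable-stable (containsCircuit? (complement C) (S ∪ e)) λ none →
        let T , maximal , S∪e⊆T = extendToMaximalClique (S ∪ e) (Subsetₚ.q⊆p∪q S e) none
            T≡K = unique T maximal (⊆-trans (Subsetₚ.q⊆p∪q S e) S∪e⊆T)
        in  containsSingleton-∁⇒⊈ outsideK
              (⊆-trans (Subsetₚ.p⊆p∪q e) (≡.subst (S ∪ e ⊆_) T≡K S∪e⊆T)))

    from : (∀ S → ContainsNonCircuit (S ∪ e) ⇔ ContainsSome (singletons (∁ K)) S) →
           IsUniqueMaximalCliqueContaining C e K
    from nonCircuit⇔ = ((cliqueK , maximalK) , e⊆K) , unique
      where
      ¬containsNonCircuit⇒⊆K : ∀ {S} → e ⊆ S → ¬ ContainsNonCircuit S → S ⊆ K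
      ¬containsNonCircuit⇒⊆K {S} e⊆S none = ¬containsSingleton-∁⇒⊆
        (none ∘ containsSome-mono (∪-lub ⊆-refl e⊆S) ∘ Equivalence.from (nonCircuit⇔ S))

      e⊆K : e ⊆ K
      e⊆K = ¬containsNonCircuit⇒⊆K ⊆-refl ¬containsNonCircuit-circuit

      cliqueK : IsClique C K
      -- The hypothesis at `S = K`: a non-circuit in `K` would give a vertex of `K` outside `K`.
      cliqueK = ¬containsNonCircuit⇒clique e⊆K λ nonCircuit → containsSingleton-∁⇒⊈
        (Equivalence.to (nonCircuit⇔ K) (containsSome-mono (Subsetₚ.p⊆p∪q e) nonCircuit))
        ⊆-refl

      clique⇒⊆K : ∀ {S} → e ⊆ S → IsClique C S → S ⊆ K
      clique⇒⊆K e⊆S = ¬containsNonCircuit⇒⊆K e⊆S ∘ clique⇒¬containsNonCircuit e⊆S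

      maximalK : ∀ T → IsClique C T → K ⊆ T → T ≡ K
      maximalK T clique K⊆T = ⊆-antisym (clique⇒⊆K (⊆-trans e⊆K K⊆T) clique) K⊆T

      unique : ∀ K′ → IsMaximalClique C K′ → e ⊆ K′ → K′ ≡ K
      unique K′ (clique , maximal) e⊆K′ =
        ≡.sym (maximal K cliqueK (clique⇒⊆K e⊆K′ clique))

-- Exposed circuits and linear divisors over a field.

module _ {c ℓ₁ ℓ₂} (𝕂 : HeytingField c ℓ₁ ℓ₂) (n : ℕ) where

  open OverField 𝕂 n
  private
    module 𝕂 = HeytingField 𝕂

  1≉0 : ¬ 𝕂.1# 𝕂.≈ 𝕂.0#
  1≉0 1≈0 = 𝕂.#-irrefl 1≈0 (HeytingProperties.1#0 𝕂.heytingCommutativeRing)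

  open SquarefreeMonomialIdeals 𝕂-commutativeRing n 1≉0

  circuitIdeal-isMonomial : (D : Clutter d n) → IsMonomialIdeal (circuitIdeal D)
  circuitIdeal-isMonomial D =
    (λ u → ∃ λ f → Circuit D f × squarefree f ≡ u) ,
    ⟨⟩-least polynomialRing (λ (f , Df) → generator (squarefree f , f , Df , ≡.refl)) ,
    ⟨⟩-least polynomialRing λ { (_ , f , Df , ≡.refl) → generator (f , Df) }

  module _ (C : Clutter d n) (1≤d : 1 ≤ d) {e : Subset n} (e∈C : Circuit C e) where

    circuit∉circuitIdeal-complement : ¬ circuitIdeal (complement C) (𝐱 e)
    circuit∉circuitIdeal-complement =
      ¬containsNonCircuit-circuit C 1≤d e∈C ∘ containsSome-resp (support-squarefree e)
        ∘ monomial∈ideal⇒containsSome (containsCircuit? (complement C))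

    -- Both sides amount to the same condition on subsets: `S ∪ e` contains a non-circuit exactly
    -- when `S` meets `∁ K`.
    uniqueMaximalClique⇔colon≐ : ∀ K → IsUniqueMaximalCliqueContaining C e K ⇔
      ((circuitIdeal (complement C) ∶ 𝐱 e) ≐ variableIdeal (∁ K))
    uniqueMaximalClique⇔colon≐ K = mk⇔
      (Equivalence.from colon ∘ Equivalence.to clique)
      (Equivalence.from clique ∘ Equivalence.to colon)
      where
      clique = uniqueMaximalClique⇔ C 1≤d e∈C K
      colon = colon≐ideal⇔ (containsCircuit? (complement C)) (containsSingleton? (∁ K)) e

    exposed⇔linearDivisor :
      IsExposed C e ⇔ IsLinearDivisor (circuitIdeal (complement C)) e
    exposed⇔linearDivisor = mk⇔
      (λ (_ , K , unique) → record
        { monomialIdeal = circuitIdeal-isMonomial (complement C)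
        ; notGenerator  = circuit∉circuitIdeal-complement ∘ proj₁
        ; colonLinear   = ∁ K , Equivalence.to (uniqueMaximalClique⇔colon≐ K) unique
        })
      -- If the variables in `S` generate the colon ideal, the clique is `∁ S`, because its
      -- complement is `S` again.
      (λ linear → let S , colon = IsLinearDivisor.colonLinear linear in
        e∈C , ∁ S , Equivalence.from (uniqueMaximalClique⇔colon≐ (∁ S))
          (≡.subst (λ T → (circuitIdeal (complement C) ∶ 𝐱 e) ≐ variableIdeal T)
            (≡.sym (∁-involutive S)) colon))
      where
      open import Algebra.Lattice.Properties.BooleanAlgebra
        (Subsetₚ.∪-∩-booleanAlgebra n) using () renaming (¬-involutive to ∁-involutive)

theorem3p1 : ∀ {c ℓ₁ ℓ₂} (d n : ℕ) → 1 ≤ d →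
    (C : Clutter d n) (𝕂 : HeytingField c ℓ₁ ℓ₂) →
    let open OverField 𝕂 n in
    (e : Subset n) → Circuit C e →
    (IsExposed C e ⇔ IsLinearDivisor (circuitIdeal (complement C)) e) ×
    (∀ (K : Subset n) →
    IsUniqueMaximalCliqueContaining C e K ⇔
    ((circuitIdeal (complement C) ∶ 𝐱 e) ≐ variableIdeal (∁ K)))
theorem3p1 d n 1≤d C 𝕂 e e∈C =
  exposed⇔linearDivisor 𝕂 n C 1≤d e∈C , uniqueMaximalClique⇔colon≐ 𝕂 n C 1≤d e∈C
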